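{- Let $\mathbf r=(r_0,r_1,\dots)$ be a sequence of nonnegative integers with finitely many nonzero entries, let $n=\sum_{d\ge1}r_d$ and $\ell=-\sum_{d\ge0}(d-1)r_d$, assume $n\ge1$ and $\ell\ge1$, let $k\ge0$ be an integer, and let $\mathbf S\in V_{\mathbf r}$. Then $$|\mathcal{CF}_{\mathbf r,k,\mathbf S}|=\ell\,1^{r_1}2^{r_2}3^{r_3}\cdots\prod_{i=1}^{n-1}\bigl(r_0+i(1+k)\bigr).$$
   Context: A plane tree is an unlabelled rooted tree in which the children of every vertex are linearly ordered; a plane forest is a finite linearly ordered sequence of plane trees. For a vertex $v$, $d_v$ is its number of children; $v$ is internal if $d_v\ge1$; $I(F)$ is the set of internal vertices of $F$. A forest is of type $\mathbf r$ if it has exactly $r_i$ vertices of degree $i$ for each $i\ge0$. A labelling of a plane forest $F$ with $n$ internal vertices is a bijection $I(F)\to\{1,\dots,n\}$; a labelled forest is a plane forest with a labelling. An internal vertex $v$ of a labelled forest is proper if no internal vertex in the subtree rooted at $v$ has a smaller label than $v$, and improper otherwise. Fix two sets of colors $\{c_1,c_2,\dots\}$ and $\{c_1',c_2',\dots\}$. A proper $k$-coloring of a labelled forest assigns to each internal vertex $v$ a color, from $\{c_1,\dots,c_{d_v}\}$ if $v$ is proper and from $\{c_1,\dots,c_{d_v}\}\cup\{c_1',\dots,c_k'\}$ if $v$ is improper. A $k$-colored labelled forest is a labelled forest with a proper $k$-coloring; $\mathcal{CF}_{\mathbf r,k}$ is the set of $k$-colored labelled forests of type $\mathbf r$. $V_{\mathbf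 r}$ is the set of sequences $\mathbf S=(S_1,S_2,\dots)$ of pairwise disjoint subsets of $\{1,\dots,n\}$ whose union is $\{1,\dots,n\}$ and with $|S_i|=r_i$ for all $i\ge1$. For $\mathbf S\in V_{\mathbf r}$, $\mathcal{CF}_{\mathbf r,k,\mathbf S}$ is the set of forests in $\mathcal{CF}_{\mathbf r,k}$ in which every internal vertex $v$ has its label in $S_{d_v}$. -}

module Defs where

open import Data.Nat using (ℕ; zero; suc; _+_; _*_; _∸_; _^_; _≤_; _≡ᵇ_)
open import Data.Bool using (if_then_else_)
open import Data.Integer as ℤ using (ℤ; +_)
open import Data.Fin as Fin using (Fin)
open import Data.Fin.Subset as Sub using (Subset; ∣_∣)
open import Data.List using (List; []; _∷_; _++_; length)
open import Data.Nat.ListAction using (sum)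
open import Data.List.Relation.Unary.All using (All)
open import Data.List.Relation.Unary.Any using (Any)
open import Data.List.Relation.Unary.Unique.Propositional using (Unique)
open import Data.List.Membership.Propositional as LMem using ()
open import Data.Vec using (Vec; []; _∷_)
open import Data.Sum using (_⊎_; inj₁; inj₂)
open import Data.Product using (Σ; ∃-syntax; _×_)
open import Data.Unit using (⊤)
open import Data.Empty using (⊥)
open import Function.Bundles using (_⇔_)
open import Relation.Binary.PropositionalEquality using (_≡_; _≢_)

-- The type r = (r_0, r_1, ...) with finitely many nonzero entries is
-- given by a finite list; entries beyond the list are 0.

rAt : List ℕ → ℕ → ℕ
rAt []      _       = 0
rAt (x ∷ r) zero    = x
rAt (x ∷ r) (suc d) = rAt r d

nInt : List ℕ → ℕ
nInt []      = 0
nInt (_ ∷ r) = sum r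

sumBelowℤ : ℕ → (ℕ → ℤ) → ℤ
sumBelowℤ zero    f = + 0
sumBelowℤ (suc m) f = sumBelowℤ m f ℤ.+ f m

-- ℓ = - Σ_{d ≥ 0} (d - 1) r_d   (terms with d ≥ length r vanish)
ell : List ℕ → ℤ
ell r = ℤ.- sumBelowℤ (length r) (λ d → (+ d ℤ.- + 1) ℤ.* + rAt r d)

prod1to : ℕ → (ℕ → ℕ) → ℕ
prod1to zero    f = 1
prod1to (suc m) f = prod1to m f * f (suc m)

-- k-colored labelled plane trees with labels in Fin n
-- (label j : Fin n stands for the label j+1 ∈ {1,…,n}; the order is the same).
-- A leaf has no label/color.  An internal vertex  node d lab col ch  has
-- exactly  suc d  children  ch  (in order), label  lab, and color  col,
-- where  inj₁ j  is the color c_{j+1} ∈ {c_1,…,c_{d_v}}  and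
--        inj₂ j  is the color c'_{j+1} ∈ {c'_1,…,c'_k}.

data CTree (n k : ℕ) : Set where
  leaf : CTree n k
  node : (d : ℕ) (lab : Fin n) (col : Fin (suc d) ⊎ Fin k)
         (ch : Vec (CTree n k) (suc d)) → CTree n k

CForest : ℕ → ℕ → Set
CForest n k = List (CTree n k)

module _ {n k : ℕ} where

  mutual
    labelsT : CTree n k → List (Fin n)
    labelsT leaf               = []
    labelsT (node d lab col ch) = lab ∷ labelsV ch

    labelsV : ∀ {m} → Vec (CTree n k) m → List (Fin n)
    labelsV []       = []
    labelsV (t ∷ ts) = labelsT t ++ labelsV ts

  mutual
    degCountT : ℕ → CTree n k → ℕ
    degCountT i leaf               = if i ≡ᵇ 0 then 1 else 0
    degCountT i (node d lab col ch) = (if i ≡ᵇ suc d then 1 else 0) + degCountV i ch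

    degCountV : ∀ {m} → ℕ → Vec (CTree n k) m → ℕ
    degCountV i []       = 0
    degCountV i (t ∷ ts) = degCountT i t + degCountV i ts

  -- a vertex with label lab and children ch is improper iff some internal
  -- vertex of its subtree has a smaller label (only descendants can).
  ImproperAt : ∀ {m} → Fin n → Vec (CTree n k) m → Set
  ImproperAt lab ch = Any (λ j → j Fin.< lab) (labelsV ch)

  ColorAllowed : ∀ {m} → Fin n → (Fin m ⊎ Fin k) → Vec (CTree n k) m → Set
  ColorAllowed lab (inj₁ _) ch = ⊤
  ColorAllowed lab (inj₂ _) ch = ImproperAt lab ch

  mutual
    ProperColoringT : CTree n k → Set
    ProperColoringT leaf                = ⊤
    ProperColoringT (node d lab col ch) = ColorAllowed lab col ch × ProperColoringV ch

    ProperColoringV : ∀ {m} → Vec (CTree n k) m → Set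
    ProperColoringV []       = ⊤
    ProperColoringV (t ∷ ts) = ProperColoringT t × ProperColoringV ts

  mutual
    LabelsInT : (ℕ → Subset n) → CTree n k → Set
    LabelsInT S leaf                = ⊤
    LabelsInT S (node d lab col ch) = (lab Sub.∈ S (suc d)) × LabelsInV S ch

    LabelsInV : ∀ {m} → (ℕ → Subset n) → Vec (CTree n k) m → Set
    LabelsInV S []       = ⊤
    LabelsInV S (t ∷ ts) = LabelsInT S t × LabelsInV S ts

  labelsF : CForest n k → List (Fin n)
  labelsF []       = []
  labelsF (t ∷ ts) = labelsT t ++ labelsF ts

  degCountF : ℕ → CForest n k → ℕ
  degCountF i []       = 0
  degCountF i (t ∷ ts) = degCountT i t + degCountF i ts

  IsLabelling : CForest n k → Set
  IsLabelling F = Unique (labelsF F) × (∀ j → j LMem.∈ labelsF F)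

  ProperColoring : CForest n k → Set
  ProperColoring F = All ProperColoringT F

  LabelsIn : (ℕ → Subset n) → CForest n k → Set
  LabelsIn S F = All (LabelsInT S) F

IsType : (r : List ℕ) {n k : ℕ} → CForest n k → Set
IsType r F = ∀ i → degCountF i F ≡ rAt r i

-- S ∈ V_r : S d (for d ≥ 1) is the set S_d; S 0 is irrelevant.
InV : (r : List ℕ) → (ℕ → Subset (nInt r)) → Set
InV r S =
  (∀ i j → 1 ≤ i → 1 ≤ j → i ≢ j → ∀ x → x Sub.∈ S i → x Sub.∈ S j → ⊥)
  × (∀ x → ∃[ i ] (1 ≤ i × x Sub.∈ S i))
  × (∀ i → 1 ≤ i → ∣ S i ∣ ≡ rAt r i)

InCF : (r : List ℕ) (k : ℕ) (S : ℕ → Subset (nInt r)) → CForest (nInt r) k → Set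
InCF r k S F = IsType r F × IsLabelling F × ProperColoring F × LabelsIn S F

HasCard : {A : Set} → (A → Set) → ℕ → Set
HasCard {A} P N =
  Σ (List A) λ L → Unique L × (∀ x → (x LMem.∈ L) ⇔ P x) × length L ≡ N

{-# OPTIONS --safe #-}
module Submission where

-- For a sorted list of labels m ∷ xs and L leaves, the number T of colored forests
-- with these labels in which the tree at position j contains the least label m
-- does not depend on j. Delete the root x of that tree, leaving its d children in place.
-- If x = m, then x is proper, has d colors, and an arbitrary forest with labels xs remains.
-- If x ≠ m, then x is improper, has d + k colors, and m lies in one of the d trees that
-- replaced x. As the number of leaves is unchanged, induction gives
-- T = (product of the degrees) · ∏_{1 ≤ i < length (m ∷ xs)} (L + i (1 + k)), and summing over
-- the position of m multiplies this by the number of trees.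

open import Defs
open import Data.Nat using (ℕ; _+_; _*_; _∸_; _^_; _≤_)
open import Data.Integer as ℤ using (ℤ; +_; ∣_∣)
open import Data.List using (List; length)
open import Data.Fin.Subset using (Subset)
open import Algebra.Structures using (IsCommutativeMonoid)
open import Data.Bool using (Bool; true; false; T; if_then_else_)
open import Data.Empty using (⊥; ⊥-elim)
open import Data.Fin as Fin using (Fin; zero; suc; _↑ˡ_)
import Data.Fin.Properties as Finₚ
import Data.Fin.Subset as Subset
open import Data.Fin.Subset.Properties using (drop-there; x∈p⇒∣p-x∣<∣p∣)
import Data.Integer.Properties as ℤₚ
import Data.Integer.Solver as ℤSolver
open import Data.List using ([]; _∷_; _++_; map; foldr; tabulate; lookup; removeAt; allFin)
open import Data.List.Properties using (length-map; length-++; length-removeAt′; ++-assoc; map-++; map-tabulate; length-tabulate)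
open import Data.List.Membership.Propositional using (_∈_; lose; find)
open import Data.List.Membership.Propositional.Properties using (∈-map⁺; ∈-map⁻; ∈-++⁺ˡ; ∈-++⁺ʳ; ∈-++⁻; ∈-lookup; ∈-allFin)
open import Data.List.Membership.Propositional.Properties.WithK using (unique∧set⇒bag)
open import Data.List.Relation.Binary.BagAndSetEquality using (∼bag⇒↭)
open import Data.List.Relation.Binary.Permutation.Propositional using (_↭_; ↭-refl; ↭-reflexive; ↭-sym; ↭-trans; prep; swap; ↭⇒↭ₛ)
open import Data.List.Relation.Binary.Permutation.Propositional.Properties using (shift; ++⁺ˡ; drop-∷; ∈-resp-↭; ↭-empty-inv; map⁺)
import Data.List.Relation.Binary.Permutation.Setoid.Properties as Permₚ
open import Data.List.Relation.Unary.All as All using (All; []; _∷_)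
open import Data.List.Relation.Unary.AllPairs as AllPairs using (AllPairs; []; _∷_)
open import Data.List.Relation.Unary.AllPairs.Properties using (tabulate⁺-<)
open import Data.List.Relation.Unary.Any using (here; there; index)
open import Data.List.Relation.Unary.Any.Properties using (lookup-index)
open import Data.List.Relation.Unary.Unique.Propositional using (Unique)
import Data.List.Relation.Unary.Unique.Propositional.Properties as Uniqueₚ
open import Data.Nat using (zero; suc; _<_; s≤s; s≤s⁻¹; z≤n; pred; _≡ᵇ_; _≟_)
open import Data.Nat.ListAction using (sum; product)
open import Data.Nat.ListAction.Properties using (sum-↭; product-↭; sum-++)
open import Data.Nat.Properties using (suc-injective; +-comm; +-assoc; +-cancelʳ-≡; *-assoc; *-identityʳ; *-zeroʳ; *-suc; ≤-refl; ≤-trans; <⇒≤; <⇒≢; ≤∧≢⇒<; ≡ᵇ⇒≡; ≡⇒≡ᵇ; +-0-isCommutativeMonoid; *-1-isCommutativeMonoid)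
open import Data.Nat.Solver using (module +-*-Solver)
open import Data.Product using (∃-syntax; _×_; _,_; proj₁; proj₂)
open import Data.Sum using (_⊎_; inj₁; inj₂; [_,_]′)
open import Data.Sum.Properties using (inj₁-injective)
open import Data.Unit using (tt)
open import Data.Vec as Vec using (Vec; []; _∷_)
import Data.Vec.Properties as Vecₚ
open import Function.Base using (_∘_; id)
open import Function.Bundles using (_⇔_; mk⇔; Equivalence)
open import Relation.Binary.PropositionalEquality using (_≡_; _≢_; refl; sym; trans; cong; cong₂; subst; setoid; module ≡-Reasoning)
open import Relation.Nullary using (yes; no)

open Equivalence using (to; from)

private variable
  A B : Set

-- Cardinalities of images and disjoint unions.

card-⇔ : ∀ {P Q : A → Set} {N} → (∀ x → P x ⇔ Q x) → HasCard P N → HasCard Q N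
card-⇔ P⇔Q (xs , uniq , ∈⇔P , len) =
  xs , uniq , (λ x → mk⇔ (to (P⇔Q x) ∘ to (∈⇔P x)) (from (∈⇔P x) ∘ from (P⇔Q x))) , len

card-image : ∀ {P : A → Set} {N} (f : A → B) → (∀ {x y} → f x ≡ f y → x ≡ y) →
  HasCard P N → HasCard (λ y → ∃[ x ] (P x × y ≡ f x)) N
card-image f f-inj (xs , uniq , ∈⇔P , len) =
  map f xs , Uniqueₚ.map⁺ f-inj uniq ,
  (λ y → mk⇔ (λ y∈ → let x , x∈ , eq = ∈-map⁻ f y∈ in x , to (∈⇔P x) x∈ , eq)
             (λ { (x , Px , refl) → ∈-map⁺ f (from (∈⇔P x) Px) })) ,
  trans (length-map f xs) len

card-⊎ : ∀ {P Q : A → Set} {M N} → (∀ x → P x → Q x → ⊥) →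
  HasCard P M → HasCard Q N → HasCard (λ x → P x ⊎ Q x) (M + N)
card-⊎ disj (xs , uniq-xs , ∈⇔P , refl) (ys , uniq-ys , ∈⇔Q , refl) =
  xs ++ ys ,
  Uniqueₚ.++⁺ uniq-xs uniq-ys (λ { {x} (x∈xs , x∈ys) → disj x (to (∈⇔P x) x∈xs) (to (∈⇔Q x) x∈ys) }) ,
  (λ x → mk⇔ (λ x∈ → [ inj₁ ∘ to (∈⇔P x) , inj₂ ∘ to (∈⇔Q x) ]′ (∈-++⁻ xs x∈))
             [ ∈-++⁺ˡ ∘ from (∈⇔P x) , ∈-++⁺ʳ xs ∘ from (∈⇔Q x) ]′) ,
  length-++ xs

card-⋃ : ∀ N {P : Fin N → A → Set} {b : Fin N → ℕ} → (∀ {i j x} → P i x → P j x → i ≡ j) →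
  (∀ i → HasCard (P i) (b i)) → HasCard (λ x → ∃[ i ] P i x) (sum (tabulate b))
card-⋃ zero disj card = [] , [] , (λ x → mk⇔ (λ ()) (λ ())) , refl
card-⋃ (suc N) disj card =
  card-⇔ (λ x → mk⇔ [ (λ p → zero , p) , (λ (i , p) → suc i , p) ]′
                    (λ { (zero , p) → inj₁ p ; (suc i , p) → inj₂ (i , p) }))
    (card-⊎ (λ { x p (i , q) → case-zero (disj p q) })
      (card zero)
      (card-⋃ N (λ p q → Finₚ.suc-injective (disj p q)) (card ∘ suc)))
  where
  case-zero : ∀ {i : Fin N} → zero ≡ suc i → ⊥
  case-zero ()

sum-tabulate-const : ∀ N c → sum (tabulate {n = N} (λ _ → c)) ≡ N * c
sum-tabulate-const zero    c = refl
sum-tabulate-const (suc N) c = cong (_+_ c) (sum-tabulate-const N c)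

card-⋃-const : ∀ N {P : Fin N → A → Set} {c} → (∀ {i j x} → P i x → P j x → i ≡ j) →
  (∀ i → HasCard (P i) c) → HasCard (λ x → ∃[ i ] P i x) (N * c)
card-⋃-const N disj card = subst (HasCard _) (sum-tabulate-const N _) (card-⋃ N disj card)

-- The sum type is the color set of an improper root: `M` ordinary colors and `N` primed ones.
-- `splitAt` and `join` reduce the union to one over `Fin (M + N)`.
card-⋃-⊎-const : ∀ M N {P : Fin M ⊎ Fin N → A → Set} {c} → (∀ {i j x} → P i x → P j x → i ≡ j) →
  (∀ i → HasCard (P i) c) → HasCard (λ x → ∃[ i ] P i x) ((M + N) * c)
card-⋃-⊎-const M N {P} disj card =
  card-⇔ (λ x → mk⇔ (λ (i , p) → Fin.splitAt M i , p)
                    (λ (i , p) → Fin.join M N i , subst (λ i → P i x) (sym (Finₚ.splitAt-join M N i)) p))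
    (card-⋃-const (M + N)
      (λ {i} {j} p q → trans (sym (Finₚ.join-splitAt M N i))
                         (trans (cong (Fin.join M N) (disj p q)) (Finₚ.join-splitAt M N j)))
      (card ∘ Fin.splitAt M))

-- Lists with one entry removed.

removeAt-↭ : ∀ (xs : List A) i → xs ↭ lookup xs i ∷ removeAt xs i
removeAt-↭ (x ∷ xs) zero    = ↭-refl
removeAt-↭ (x ∷ xs) (suc i) = ↭-trans (prep x (removeAt-↭ xs i)) (swap x _ ↭-refl)

removeAt-All : ∀ {P : A → Set} {xs : List A} i → All P xs → All P (removeAt xs i)
removeAt-All zero    (_ ∷ ps) = ps
removeAt-All (suc i) (p ∷ ps) = p ∷ removeAt-All i ps

removeAt-AllPairs : ∀ {R : A → A → Set} {xs : List A} i → AllPairs R xs → AllPairs R (removeAt xs i)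
removeAt-AllPairs zero    (_ ∷ rs) = rs
removeAt-AllPairs (suc i) (r ∷ rs) = removeAt-All i r ∷ removeAt-AllPairs i rs

lookup-injective : ∀ {xs : List A} → Unique xs → ∀ {i j} → lookup xs i ≡ lookup xs j → i ≡ j
lookup-injective {xs = x ∷ xs} _ {zero} {zero} eq = refl
lookup-injective {xs = x ∷ xs} (x∉ ∷ _) {zero} {suc j} eq = ⊥-elim (All.lookup x∉ (∈-lookup j) eq)
lookup-injective {xs = x ∷ xs} (x∉ ∷ _) {suc i} {zero} eq = ⊥-elim (All.lookup x∉ (∈-lookup i) (sym eq))
lookup-injective {xs = x ∷ xs} (_ ∷ uniq) {suc i} {suc j} eq = cong suc (lookup-injective uniq eq)

sorted⇒unique : ∀ {n} {xs : List (Fin n)} → AllPairs Fin._<_ xs → Unique xs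
sorted⇒unique = AllPairs.map Finₚ.<⇒≢

-- Positions of trees after a root is deleted.

-- expand d j is the size of a forest of size ℓ after the tree at position j
-- has been replaced by d + 1 trees, and inner j enumerates their positions.

expand : ∀ {ℓ} → ℕ → Fin ℓ → ℕ
expand {suc q} d zero    = suc d + q
expand {suc ℓ} d (suc j) = suc (expand d j)

expand-≡ : ∀ {ℓ} d (j : Fin ℓ) → expand d j ≡ ℓ + d
expand-≡ {suc q} d zero    = cong suc (+-comm d q)
expand-≡ {suc ℓ} d (suc j) = cong suc (expand-≡ d j)

inner : ∀ {ℓ d} (j : Fin ℓ) → Fin (suc d) → Fin (expand d j)
inner zero    i = i ↑ˡ _
inner (suc j) i = suc (inner j i)

inner-injective : ∀ {ℓ d} (j : Fin ℓ) {i i′ : Fin (suc d)} → inner j i ≡ inner j i′ → i ≡ i′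
inner-injective zero    eq = Finₚ.↑ˡ-injective _ _ _ eq
inner-injective (suc j) eq = inner-injective j (Finₚ.suc-injective eq)

children : ∀ {ℓ d} (j : Fin ℓ) → Vec A (expand d j) → Vec A (suc d)
children {d = d} zero F       = Vec.take (suc d) F
children (suc j)      (t ∷ F) = children j F

lookup-children : ∀ {ℓ d} (j : Fin ℓ) (F : Vec A (expand d j)) i →
  Vec.lookup (children j F) i ≡ Vec.lookup F (inner j i)
lookup-children {d = d} zero F i =
  trans (sym (Vecₚ.lookup-++ˡ (Vec.take (suc d) F) (Vec.drop (suc d) F) i))
        (cong (λ F → Vec.lookup F (i ↑ˡ _)) (Vecₚ.take++drop≡id (suc d) F))
lookup-children (suc j) (t ∷ F) i = lookup-children j F i

-- Deleting and grafting the root of one tree of a forest.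

module _ {n k : ℕ} where

  private variable
    ℓ m d : ℕ
    x : Fin n

  labelsV-++ : (F : Vec (CTree n k) ℓ) (G : Vec (CTree n k) m) →
    labelsV (F Vec.++ G) ≡ labelsV F ++ labelsV G
  labelsV-++ []      G = refl
  labelsV-++ (t ∷ F) G = trans (cong (labelsT t ++_) (labelsV-++ F G)) (sym (++-assoc (labelsT t) _ _))

  ∈-labelsV⁺ : (F : Vec (CTree n k) ℓ) (i : Fin ℓ) → x ∈ labelsT (Vec.lookup F i) → x ∈ labelsV F
  ∈-labelsV⁺ (t ∷ F) zero    x∈ = ∈-++⁺ˡ x∈
  ∈-labelsV⁺ (t ∷ F) (suc i) x∈ = ∈-++⁺ʳ (labelsT t) (∈-labelsV⁺ F i x∈)

  ∈-labelsV⁻ : (F : Vec (CTree n k) ℓ) → x ∈ labelsV F → ∃[ i ] x ∈ labelsT (Vec.lookup F i)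
  ∈-labelsV⁻ (t ∷ F) x∈ with ∈-++⁻ (labelsT t) x∈
  ... | inj₁ x∈t = zero , x∈t
  ... | inj₂ x∈F = let i , x∈ = ∈-labelsV⁻ F x∈F in suc i , x∈

  -- Different trees occupy different stretches of the concatenated label list, so a shared label
  -- would be a repetition. This makes the cases by position of a label disjoint.
  tree-of-label-unique : (F : Vec (CTree n k) ℓ) → Unique (labelsV F) → ∀ i j →
    x ∈ labelsT (Vec.lookup F i) → x ∈ labelsT (Vec.lookup F j) → i ≡ j
  tree-of-label-unique (t ∷ F) uniq zero zero x∈i x∈j = refl
  tree-of-label-unique (t ∷ F) uniq zero (suc j) x∈i x∈j =
    ⊥-elim (++-disjoint (labelsT t) uniq x∈i (∈-labelsV⁺ F j x∈j))
    where
    ++-disjoint : ∀ (xs : List (Fin n)) {ys y} → Unique (xs ++ ys) → y ∈ xs → y ∈ ys → ⊥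
    ++-disjoint (x ∷ xs) (x∉ ∷ u) (here refl) y∈ys = All.lookup x∉ (∈-++⁺ʳ xs y∈ys) refl
    ++-disjoint (x ∷ xs) (x∉ ∷ u) (there y∈xs) y∈ys = ++-disjoint xs u y∈xs y∈ys
  tree-of-label-unique F@(_ ∷ _) uniq (suc i) zero x∈i x∈j =
    sym (tree-of-label-unique F uniq zero (suc i) x∈j x∈i)
  tree-of-label-unique (t ∷ F) uniq (suc i) (suc j) x∈i x∈j =
    cong suc (tree-of-label-unique F (++⁻ʳ (labelsT t) uniq) i j x∈i x∈j)
    where
    ++⁻ʳ : ∀ (xs : List (Fin n)) {ys} → Unique (xs ++ ys) → Unique ys
    ++⁻ʳ []       u       = u
    ++⁻ʳ (x ∷ xs) (_ ∷ u) = ++⁻ʳ xs u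

  -- Inverse to deleting the root of the tree at position `j`. With label and color fixed it is an
  -- injective function of the remaining forest, so forests with a prescribed root can be counted as
  -- an image.
  graft : (j : Fin ℓ) (d : ℕ) → Fin n → Fin (suc d) ⊎ Fin k →
    Vec (CTree n k) (expand d j) → Vec (CTree n k) ℓ
  graft zero    d x col F       = node d x col (Vec.take (suc d) F) ∷ Vec.drop (suc d) F
  graft (suc j) d x col (t ∷ F) = t ∷ graft j d x col F

  lookup-graft : (j : Fin ℓ) {col : Fin (suc d) ⊎ Fin k} (F : Vec (CTree n k) (expand d j)) →
    Vec.lookup (graft j d x col F) j ≡ node d x col (children j F)
  lookup-graft zero    F       = refl
  lookup-graft (suc j) (t ∷ F) = lookup-graft j F

  graft-injective : (j : Fin ℓ) {col : Fin (suc d) ⊎ Fin k} {F G : Vec (CTree n k) (expand d j)} →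
    graft j d x col F ≡ graft j d x col G → F ≡ G
  graft-injective {d = d} zero {F = F} {G} eq =
    trans (sym (Vecₚ.take++drop≡id (suc d) F))
      (trans (cong₂ Vec._++_ (node-injective (Vecₚ.∷-injectiveˡ eq)) (Vecₚ.∷-injectiveʳ eq))
        (Vecₚ.take++drop≡id (suc d) G))
    where
    node-injective : ∀ {x col ch ch′} → node {n} {k} d x col ch ≡ node d x col ch′ → ch ≡ ch′
    node-injective refl = refl
  graft-injective (suc j) {F = t ∷ F} {_ ∷ G} eq =
    cong₂ _∷_ (Vecₚ.∷-injectiveˡ eq) (graft-injective j (Vecₚ.∷-injectiveʳ eq))

  graft-surjective : (j : Fin ℓ) (F : Vec (CTree n k) ℓ) {col : Fin (suc d) ⊎ Fin k}
    {ch : Vec (CTree n k) (suc d)} →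
    Vec.lookup F j ≡ node d x col ch → ∃[ G ] F ≡ graft j d x col G
  graft-surjective {d = d} {x = x} zero (_ ∷ F) {col} {ch} refl =
    ch Vec.++ F ,
    cong₂ (λ ch F → node d x col ch ∷ F) (proj₁ split) (proj₂ split)
    where
    -- Cutting `ch ++ F` after `suc d` entries gives back `ch` and `F`.
    split = Vecₚ.++-injective ch (Vec.take (suc d) (ch Vec.++ F))
              (sym (Vecₚ.take++drop≡id (suc d) (ch Vec.++ F)))
  graft-surjective (suc j) (t ∷ F) eq =
    let G , F≡ = graft-surjective j F eq in t ∷ G , cong (t ∷_) F≡

  -- The new label comes after those of the trees before position `j`, so it reaches the front only
  -- up to permutation.
  labelsV-graft : (j : Fin ℓ) {col : Fin (suc d) ⊎ Fin k} (F : Vec (CTree n k) (expand d j)) →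
    labelsV (graft j d x col F) ↭ x ∷ labelsV F
  labelsV-graft {d = d} {x = x} zero F = prep x (↭-reflexive
    (trans (sym (labelsV-++ (Vec.take (suc d) F) _)) (cong labelsV (Vecₚ.take++drop≡id (suc d) F))))
  labelsV-graft (suc j) (t ∷ F) =
    ↭-trans (++⁺ˡ (labelsT t) (labelsV-graft j F)) (shift _ (labelsT t) (labelsV F))

  proper-++ : (F : Vec (CTree n k) ℓ) {G : Vec (CTree n k) m} →
    ProperColoringV (F Vec.++ G) ⇔ (ProperColoringV F × ProperColoringV G)
  proper-++ []      = mk⇔ (λ pG → tt , pG) proj₂
  proper-++ (t ∷ F) = mk⇔
    (λ (pt , pFG) → let pF , pG = to (proper-++ F) pFG in (pt , pF) , pG)
    (λ ((pt , pF) , pG) → pt , from (proper-++ F) (pF , pG))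

  labelsIn-++ : ∀ {S} (F : Vec (CTree n k) ℓ) {G : Vec (CTree n k) m} →
    LabelsInV S (F Vec.++ G) ⇔ (LabelsInV S F × LabelsInV S G)
  labelsIn-++ []      = mk⇔ (λ pG → tt , pG) proj₂
  labelsIn-++ (t ∷ F) = mk⇔
    (λ (pt , pFG) → let pF , pG = to (labelsIn-++ F) pFG in (pt , pF) , pG)
    (λ ((pt , pF) , pG) → pt , from (labelsIn-++ F) (pF , pG))

  -- The grafted vertex is a root, so every older vertex keeps its subtree and with it its set of
  -- allowed colors. Only the condition at the new root is added.
  proper-graft : (j : Fin ℓ) {col : Fin (suc d) ⊎ Fin k} (F : Vec (CTree n k) (expand d j)) →
    ProperColoringV (graft j d x col F) ⇔ (ColorAllowed x col (children j F) × ProperColoringV F)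
  proper-graft {d = d} zero F = mk⇔
    (λ ((c , pch) , pF) → c ,
      subst ProperColoringV (Vecₚ.take++drop≡id (suc d) F) (from (proper-++ (Vec.take (suc d) F)) (pch , pF)))
    (λ (c , p) → let pch , pF = to (proper-++ (Vec.take (suc d) F))
                                   (subst ProperColoringV (sym (Vecₚ.take++drop≡id (suc d) F)) p)
                 in (c , pch) , pF)
  proper-graft (suc j) (t ∷ F) = mk⇔
    (λ (pt , p) → let c , pF = to (proper-graft j F) p in c , pt , pF)
    (λ (c , pt , pF) → pt , from (proper-graft j F) (c , pF))

  labelsIn-graft : ∀ {S} (j : Fin ℓ) {col : Fin (suc d) ⊎ Fin k} (F : Vec (CTree n k) (expand d j)) →
    LabelsInV S (graft j d x col F) ⇔ ((x Subset.∈ S (suc d)) × LabelsInV S F)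
  labelsIn-graft {d = d} zero F = mk⇔
    (λ ((c , pch) , pF) → c ,
      subst (LabelsInV _) (Vecₚ.take++drop≡id (suc d) F) (from (labelsIn-++ (Vec.take (suc d) F)) (pch , pF)))
    (λ (c , p) → let pch , pF = to (labelsIn-++ (Vec.take (suc d) F))
                                   (subst (LabelsInV _) (sym (Vecₚ.take++drop≡id (suc d) F)) p)
                 in (c , pch) , pF)
  labelsIn-graft (suc j) (t ∷ F) = mk⇔
    (λ (pt , p) → let c , pF = to (labelsIn-graft j F) p in c , pt , pF)
    (λ (c , pt , pF) → pt , from (labelsIn-graft j F) (c , pF))

-- Forests with a prescribed list of labels.

module Counting {n : ℕ} (k : ℕ) (S : ℕ → Subset n) (δ : Fin n → ℕ)
  (∈S⇔δ : ∀ x d → (x Subset.∈ S (suc d)) ⇔ (d ≡ δ x)) where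

  -- Since `S` forces the vertex labelled `x` to have `suc (δ x)` children, the labels and the
  -- number `ℓ` of trees determine the type, which is therefore not recorded. The list `xs` is
  -- arbitrary because the recursion removes labels.
  Good : ∀ {ℓ} → List (Fin n) → Vec (CTree n k) ℓ → Set
  Good xs F = labelsV F ↭ xs × ProperColoringV F × LabelsInV S F

  good-graft : ∀ {ℓ x xs} (j : Fin ℓ) {col} (F : Vec (CTree n k) (expand (δ x) j)) →
    Good (x ∷ xs) (graft j (δ x) x col F) ⇔ (ColorAllowed x col (children j F) × Good xs F)
  good-graft j F = mk⇔
    (λ (l , p , i) → let c , p′ = to (proper-graft j F) p in
      c , drop-∷ (↭-trans (↭-sym (labelsV-graft j F)) l) , p′ , proj₂ (to (labelsIn-graft j F) i))
    (λ (c , l , p , i) →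
      ↭-trans (labelsV-graft j F) (prep _ l) ,
      from (proper-graft j F) (c , p) ,
      from (labelsIn-graft j F) (from (∈S⇔δ _ _) refl , i))

  good-resp-↭ : ∀ {ℓ xs ys} {F : Vec (CTree n k) ℓ} → xs ↭ ys → Good xs F → Good ys F
  good-resp-↭ xs↭ys (l , p) = ↭-trans l xs↭ys , p

  good-unique : ∀ {ℓ xs} {F : Vec (CTree n k) ℓ} → AllPairs Fin._<_ xs → Good xs F → Unique (labelsV F)
  good-unique sorted (l , _) = Permₚ.Unique-resp-↭ (setoid (Fin n)) (↭⇒↭ₛ (↭-sym l)) (sorted⇒unique sorted)

  -- A tree without labels is a single leaf, so only the row of `ℓ` leaves remains.
  card-good-[] : ∀ ℓ → HasCard (Good {ℓ} []) 1
  card-good-[] ℓ =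
    Vec.replicate ℓ leaf ∷ [] , [] ∷ [] ,
    (λ F → mk⇔ (λ { (here refl) → leaves-good ℓ })
               (λ (l , _) → here (no-labels F (↭-empty-inv l)))) ,
    refl
    where
    leaves-good : ∀ ℓ → Good [] (Vec.replicate ℓ leaf)
    leaves-good zero    = ↭-refl , tt , tt
    leaves-good (suc ℓ) = let l , p , i = leaves-good ℓ in l , (tt , p) , (tt , i)
    no-labels : ∀ {ℓ} (F : Vec (CTree n k) ℓ) → labelsV F ≡ [] → F ≡ Vec.replicate ℓ leaf
    no-labels []         eq = refl
    no-labels (leaf ∷ F) eq = cong (leaf ∷_) (no-labels F eq)

  -- The tree at position j has root x with color col, and deleting this root
  -- leaves a forest satisfying P.
  Rooted : ∀ {ℓ} (j : Fin ℓ) (x : Fin n) (col : Fin (suc (δ x)) ⊎ Fin k) →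
    (Vec (CTree n k) (expand (δ x) j) → Set) → Vec (CTree n k) ℓ → Set
  Rooted j x col P F = ∃[ G ] (P G × F ≡ graft j (δ x) x col G)

  card-rooted : ∀ {ℓ} (j : Fin ℓ) x col {P N} → HasCard P N → HasCard (Rooted j x col P) N
  card-rooted j x col = card-image (graft j (δ x) x col) (graft-injective j)

  -- Root label and root color can be read off the tree at position `j`; hence the cases with
  -- different roots or colors are disjoint.
  rooted-lookup : ∀ {ℓ} {j : Fin ℓ} {x col P F} → Rooted j x col P F →
    ∃[ ch ] Vec.lookup F j ≡ node (δ x) x col ch
  rooted-lookup {j = j} (G , _ , refl) = children j G , lookup-graft j G

  rooted-label-≡ : ∀ {ℓ} {j : Fin ℓ} {x x′ col col′ P P′ F} →
    Rooted j x col P F → Rooted j x′ col′ P′ F → x ≡ x′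
  rooted-label-≡ r r′ = node-label (trans (sym (proj₂ (rooted-lookup r))) (proj₂ (rooted-lookup r′)))
    where
    node-label : ∀ {d d′ x x′ col col′ ch ch′} →
      node {n} {k} d x col ch ≡ node d′ x′ col′ ch′ → x ≡ x′
    node-label refl = refl

  rooted-color-≡ : ∀ {ℓ} {j : Fin ℓ} {x col col′ P P′ F} →
    Rooted j x col P F → Rooted j x col′ P′ F → col ≡ col′
  rooted-color-≡ r r′ = node-color (trans (sym (proj₂ (rooted-lookup r))) (proj₂ (rooted-lookup r′)))
    where
    node-color : ∀ {d x col col′ ch ch′} → node {n} {k} d x col ch ≡ node d x col′ ch′ → col ≡ col′
    node-color refl = refl

  -- Case distinction on the root above the least label.

  HeadAt : ∀ {ℓ} → Fin n → List (Fin n) → Fin ℓ → Vec (CTree n k) ℓ → Set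
  HeadAt m xs j F = Good (m ∷ xs) F × m ∈ labelsT (Vec.lookup F j)

  -- A root other than `m` is named by its index `i` in `xs`, and `i′` tells which of the trees
  -- freed by its deletion contains `m`. All choices thus range over finite index types and can be
  -- summed.
  HeadIsRoot HeadBelowRoot : ∀ {ℓ} → Fin n → List (Fin n) → Fin ℓ → Vec (CTree n k) ℓ → Set
  HeadIsRoot m xs j F = ∃[ c ] Rooted j m (inj₁ c) (Good xs) F
  HeadBelowRoot m xs j F = ∃[ i ] ∃[ col ] Rooted j (lookup xs i) col
    (λ G → ∃[ i′ ] HeadAt m (removeAt xs i) (inner j i′) G) F

  labelsIn-lookup : ∀ {ℓ} (F : Vec (CTree n k) ℓ) j → LabelsInV S F → LabelsInT S (Vec.lookup F j)
  labelsIn-lookup (t ∷ F) zero    (p , _) = p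
  labelsIn-lookup (t ∷ F) (suc j) (_ , p) = labelsIn-lookup F j p

  -- In both cases the color condition at the root is settled at once. No label lies below `m`, so a
  -- root `m` is proper and takes only colors `inj₁`; any other root has the smaller label `m`
  -- beneath it, so it is improper and takes every color.
  root-decomposition : ∀ {ℓ m xs} → All (m Fin.<_) xs → (j : Fin ℓ) → ∀ F →
    (HeadIsRoot m xs j F ⊎ HeadBelowRoot m xs j F) ⇔ HeadAt m xs j F
  root-decomposition {m = m} {xs} m< j F = mk⇔
    [ (λ { (c , G , good , refl) →
           from (good-graft j G) (tt , good) , subst (λ t → m ∈ labelsT t) (sym (lookup-graft j G)) (here refl) })
    , (λ { (i , col , G , (i′ , good , m∈) , refl) → below i col G i′ good m∈ }) ]′
    (λ (good , m∈) → decompose good m∈ (Vec.lookup F j) refl)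
    where
    allowed : ∀ {x d} (col : Fin d ⊎ Fin k) (ch : Vec (CTree n k) d) → m Fin.< x → m ∈ labelsV ch →
      ColorAllowed x col ch
    allowed (inj₁ _) ch m<x m∈ = tt
    allowed (inj₂ _) ch m<x m∈ = lose m∈ m<x

    below : ∀ i col (G : Vec (CTree n k) (expand (δ (lookup xs i)) j)) i′ →
      Good (m ∷ removeAt xs i) G → m ∈ labelsT (Vec.lookup G (inner j i′)) →
      HeadAt m xs j (graft j _ (lookup xs i) col G)
    below i col G i′ good m∈ =
      -- `good-graft` lists the root label first; the permutation moves it behind `m` and back to
      -- index `i`.
      good-resp-↭ (↭-trans (swap _ _ ↭-refl) (prep m (↭-sym (removeAt-↭ xs i))))
        (from (good-graft j G) (allowed col (children j G) (All.lookup m< (∈-lookup i)) m∈ch , good)) ,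
      subst (λ t → m ∈ labelsT t) (sym (lookup-graft j G)) (there m∈ch)
      where
      m∈ch : m ∈ labelsV (children j G)
      m∈ch = ∈-labelsV⁺ (children j G) i′
               (subst (λ t → m ∈ labelsT t) (sym (lookup-children j G i′)) m∈)

    children-⊆ : ∀ {d y} (G : Vec (CTree n k) (expand d j)) → y ∈ labelsV (children j G) → y ∈ labelsV G
    children-⊆ G y∈ = let i , y∈i = ∈-labelsV⁻ (children j G) y∈ in
      ∈-labelsV⁺ G (inner j i) (subst (λ t → _ ∈ labelsT t) (lookup-children j G i) y∈i)

    decompose-graft : ∀ {x} col (G : Vec (CTree n k) (expand (δ x) j)) → F ≡ graft j (δ x) x col G →
      x ∈ m ∷ xs → Good (m ∷ xs) F → m ∈ labelsT (Vec.lookup F j) →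
      HeadIsRoot m xs j F ⊎ HeadBelowRoot m xs j F
    decompose-graft (inj₁ c) G refl (here refl) good m∈ =
      inj₁ (c , G , proj₂ (to (good-graft j G) good) , refl)
    -- A primed color at `m` would require a smaller label among the descendants, but these carry
    -- labels from `xs`, all larger than `m`.
    decompose-graft (inj₂ c) G refl (here refl) good m∈ with to (good-graft j G) good
    ... | improper , labels , _ =
      let y , y∈ , y<m = find improper
      in ⊥-elim (Finₚ.<-asym y<m (All.lookup m< (∈-resp-↭ labels (children-⊆ G y∈))))
    -- `at-index` takes a free index `i`, because `index x∈` depends on `x` and the equation with
    -- `lookup xs` could not be matched otherwise.
    decompose-graft {x} col G refl (there x∈) good m∈ =
      inj₂ (at-index (index x∈) (lookup-index x∈) col G good m∈)
      where
      at-index : ∀ i {x} → x ≡ lookup xs i → ∀ col (G : Vec (CTree n k) (expand (δ x) j)) →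
        Good (m ∷ xs) (graft j (δ x) x col G) → m ∈ labelsT (Vec.lookup (graft j (δ x) x col G) j) →
        HeadBelowRoot m xs j (graft j (δ x) x col G)
      at-index i refl col G good m∈ = i , col , G , (proj₁ m-child , good′ , m∈inner) , refl
        where
        good′ : Good (m ∷ removeAt xs i) G
        good′ = proj₂ (to (good-graft j G)
          (good-resp-↭ (↭-trans (prep m (removeAt-↭ xs i)) (swap _ _ ↭-refl)) good))
        m∈ch : m ∈ labelsV (children j G)
        m∈ch with subst (λ t → m ∈ labelsT t) (lookup-graft j G) m∈
        ... | here m≡x = ⊥-elim (Finₚ.<⇒≢ (All.lookup m< (∈-lookup i)) m≡x)
        ... | there m∈ = m∈
        m-child = ∈-labelsV⁻ (children j G) m∈ch
        m∈inner = subst (λ t → m ∈ labelsT t) (lookup-children j G (proj₁ m-child)) (proj₂ m-child)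

    decompose : Good (m ∷ xs) F → m ∈ labelsT (Vec.lookup F j) → ∀ t → Vec.lookup F j ≡ t →
      HeadIsRoot m xs j F ⊎ HeadBelowRoot m xs j F
    decompose good m∈ leaf eq with () ← subst (λ t → m ∈ labelsT t) eq m∈
    -- The root label lies in `S (suc d)`, which forces `d` to be `δ x`, the degree that `Rooted`
    -- prescribes.
    decompose good@(labels , _ , labelsIn) m∈ (node d x col ch) eq
      with refl ← to (∈S⇔δ x d) (proj₁ (subst (LabelsInT S) eq (labelsIn-lookup F j labelsIn))) =
      let G , F≡ = graft-surjective j F eq in
      decompose-graft col G F≡
        (∈-resp-↭ labels (∈-labelsV⁺ F j (subst (λ t → x ∈ labelsT t) (sym eq) (here refl)))) good m∈

  -- The product formula for forests with sorted labels.

  excess : List (Fin n) → ℕ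
  excess xs = sum (map δ xs)

  degProduct : List (Fin n) → ℕ
  degProduct xs = product (map (suc ∘ δ) xs)

  -- `L` stands for the number of leaves, which is `ℓ + excess xs` for `ℓ` trees. Deleting a root
  -- changes `ℓ` but not `L`, so the factors of the product stay the same throughout the recursion.
  weight : List (Fin n) → ℕ → ℕ
  weight xs L = degProduct xs * prod1to (length xs ∸ 1) (λ i → L + i * (1 + k))

  excess-removeAt : ∀ xs i → excess xs ≡ δ (lookup xs i) + excess (removeAt xs i)
  excess-removeAt xs i = sum-↭ (map⁺ δ (removeAt-↭ xs i))

  degProduct-removeAt : ∀ xs i → degProduct xs ≡ suc (δ (lookup xs i)) * degProduct (removeAt xs i)
  degProduct-removeAt xs i = product-↭ (map⁺ (suc ∘ δ) (removeAt-↭ xs i))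

  -- An improper root `x` has `δ x + (1 + k)` colors. The parts `δ x` add up to the excess, and
  -- `1 + k` appears once per label, which is the source of the terms `i * (1 + k)`.
  sum-colors : ∀ xs C →
    sum (tabulate (λ i → (suc (δ (lookup xs i)) + k) * C)) ≡ (excess xs + length xs * (1 + k)) * C
  sum-colors []       C = refl
  sum-colors (x ∷ xs) C = trans (cong (_+_ ((suc (δ x) + k) * C)) (sum-colors xs C))
    (solve 5 (λ d e l k C → (con 1 :+ d :+ k) :* C :+ (e :+ l :* (con 1 :+ k)) :* C
                         := (d :+ e :+ (con 1 :+ k :+ l :* (con 1 :+ k))) :* C) refl
      (δ x) (excess xs) (length xs) k C)
    where open +-*-Solver

  headAt-disjoint : ∀ {ℓ m xs} → AllPairs Fin._<_ (m ∷ xs) → {i j : Fin ℓ} → ∀ {F} →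
    HeadAt m xs i F → HeadAt m xs j F → i ≡ j
  headAt-disjoint sorted {F = F} (good , m∈i) (_ , m∈j) =
    tree-of-label-unique F (good-unique sorted good) _ _ m∈i m∈j

  -- The label `m` lies in exactly one of the `ℓ` trees, and each position contributes the same `N`.
  card-good-∷ : ∀ {m xs N} → AllPairs Fin._<_ (m ∷ xs) → ∀ ℓ →
    (∀ (j : Fin ℓ) → HasCard (HeadAt m xs j) N) → HasCard (Good {ℓ} (m ∷ xs)) (ℓ * N)
  card-good-∷ sorted ℓ card =
    card-⇔ (λ F → mk⇔ (λ (_ , good , _) → good)
                      (λ good → let j , m∈ = ∈-labelsV⁻ F (∈-resp-↭ (↭-sym (proj₁ good)) (here refl))
                                in j , good , m∈))
      (card-⋃-const ℓ (headAt-disjoint sorted) card)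

  -- Induction on the number `s` of labels besides `m`: the recursion goes to `xs` and to
  -- `m ∷ removeAt xs i`, and the latter is not a tail of the list. `ℓ` and `j` stay general, since
  -- deleting a root changes both.
  card-headAt : ∀ s {m xs} → length xs ≡ s → AllPairs Fin._<_ (m ∷ xs) → ∀ {ℓ} (j : Fin ℓ) →
    HasCard (HeadAt m xs j) (weight (m ∷ xs) (ℓ + excess (m ∷ xs)))
  card-headAt zero {m} {[]} refl sorted {ℓ} j =
    subst (HasCard _) (solve 1 (λ d → d :* con 1 :+ con 0 := d :* con 1 :* con 1) refl (suc (δ m)))
      (card-⇔ (root-decomposition (AllPairs.head sorted) j)
        (card-⊎ (λ { F _ (() , _) })
          (card-⋃-const (suc (δ m)) (λ r r′ → inj₁-injective (rooted-color-≡ r r′))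
            (λ c → card-rooted j m (inj₁ c) (card-good-[] _)))
          -- With `m` the only label, no other vertex can be the root.
          (card-⋃ 0 {b = λ ()} (λ { {()} }) (λ ()))))
    where open +-*-Solver
  card-headAt (suc s) {m} {xs@(a ∷ as)} len sorted@(m< ∷ sorted-xs) {ℓ} j =
    subst (HasCard _) total
      (card-⇔ (root-decomposition m< j)
        (card-⊎ (λ { F (_ , r) (i , _ , r′) → Finₚ.<⇒≢ (All.lookup m< (∈-lookup i)) (rooted-label-≡ r r′) })
          (card-⋃-const (suc (δ m)) (λ r r′ → inj₁-injective (rooted-color-≡ r r′))
            (λ c → card-rooted j m (inj₁ c)
              (card-good-∷ sorted-xs _ (card-headAt s (suc-injective len) sorted-xs))))
          (card-⋃ (length xs)
            (λ (_ , r) (_ , r′) → lookup-injective (sorted⇒unique sorted-xs) (rooted-label-≡ r r′))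
            below)))
    where
    open +-*-Solver
    L = ℓ + excess (m ∷ xs)
    Pr : ℕ → ℕ
    Pr L = prod1to (length as) (λ i → L + i * (1 + k))
    C = degProduct (m ∷ xs) * Pr L

    below : ∀ i → HasCard (λ F → ∃[ col ] Rooted j (lookup xs i) col
                     (λ G → ∃[ i′ ] HeadAt m (removeAt xs i) (inner j i′) G) F)
                    ((suc (δ (lookup xs i)) + k) * C)
    below i = card-⋃-⊎-const (suc (δ x)) k rooted-color-≡ (λ col → card-rooted j x col
        (subst (HasCard _) count
          (card-⋃-const (suc (δ x)) (λ h h′ → inner-injective j (headAt-disjoint sorted′ h h′))
            (λ i′ → card-headAt s (trans length≡ (suc-injective len)) sorted′ (inner j i′)))))
      where
      x = lookup xs i
      sorted′ : AllPairs Fin._<_ (m ∷ removeAt xs i)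
      sorted′ = removeAt-All i m< ∷ removeAt-AllPairs i sorted-xs
      length≡ : length (removeAt xs i) ≡ length as
      length≡ = suc-injective (sym (length-removeAt′ xs i))
      -- Deleting `x` adds `δ x` trees and lowers the excess by `δ x`.
      L≡ : expand (δ x) j + excess (m ∷ removeAt xs i) ≡ L
      L≡ = begin
        expand (δ x) j + (δ m + excess (removeAt xs i))
          ≡⟨ cong (λ e → e + (δ m + excess (removeAt xs i))) (expand-≡ (δ x) j) ⟩
        ℓ + δ x + (δ m + excess (removeAt xs i))
          ≡⟨ solve 4 (λ l x m e → l :+ x :+ (m :+ e) := l :+ (m :+ (x :+ e))) refl
               ℓ (δ x) (δ m) (excess (removeAt xs i)) ⟩
        ℓ + (δ m + (δ x + excess (removeAt xs i)))
          ≡⟨ cong (λ e → ℓ + (δ m + e)) (excess-removeAt xs i) ⟨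
        L ∎
        where open ≡-Reasoning
      -- The `suc (δ x)` possible places of `m` among the freed trees restore the factor that `x`
      -- contributes to the degree product. So `C` is the same for every root `x` and every color.
      count : suc (δ x) * weight (m ∷ removeAt xs i) (expand (δ x) j + excess (m ∷ removeAt xs i)) ≡ C
      count = begin
        suc (δ x) * weight (m ∷ removeAt xs i) (expand (δ x) j + excess (m ∷ removeAt xs i))
          ≡⟨ cong₂ (λ len L → suc (δ x) * (degProduct (m ∷ removeAt xs i) * prod1to len (λ i → L + i * (1 + k))))
               length≡ L≡ ⟩
        suc (δ x) * (suc (δ m) * degProduct (removeAt xs i) * Pr L)
          ≡⟨ solve 4 (λ x m p q → x :* (m :* p :* q) := m :* (x :* p) :* q) refl
               (suc (δ x)) (suc (δ m)) (degProduct (removeAt xs i)) (Pr L) ⟩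
        suc (δ m) * (suc (δ x) * degProduct (removeAt xs i)) * Pr L
          ≡⟨ cong (λ p → suc (δ m) * p * Pr L) (degProduct-removeAt xs i) ⟨
        C ∎
        where open ≡-Reasoning

    -- Apart from the common factor `C`, a root `m` contributes the number of trees `ℓ + δ m`, and
    -- the other roots contribute `excess xs + length xs * (1 + k)`. Together they give
    -- `L + length xs * (1 + k)`, the last factor of the product.
    total : suc (δ m) * (expand (δ m) j * weight xs (expand (δ m) j + excess xs))
              + sum (tabulate (λ i → (suc (δ (lookup xs i)) + k) * C))
            ≡ weight (m ∷ xs) L
    total = begin
      suc (δ m) * (expand (δ m) j * weight xs (expand (δ m) j + excess xs))
          + sum (tabulate (λ i → (suc (δ (lookup xs i)) + k) * C))
        ≡⟨ cong₂ (λ e t → suc (δ m) * (e * weight xs (e + excess xs)) + t) (expand-≡ (δ m) j) (sum-colors xs C) ⟩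
      suc (δ m) * ((ℓ + δ m) * (degProduct xs * Pr (ℓ + δ m + excess xs)))
          + (excess xs + length xs * (1 + k)) * C
        ≡⟨ cong (λ L → suc (δ m) * ((ℓ + δ m) * (degProduct xs * Pr L))
                       + (excess xs + length xs * (1 + k)) * C) (+-assoc ℓ (δ m) (excess xs)) ⟩
      suc (δ m) * ((ℓ + δ m) * (degProduct xs * Pr L))
          + (excess xs + length xs * (1 + k)) * (suc (δ m) * degProduct xs * Pr L)
        ≡⟨ solve 7 (λ m l d p q e t → m :* ((l :+ d) :* (p :* q)) :+ (e :+ t) :* (m :* p :* q)
                                    := m :* p :* (q :* (l :+ (d :+ e) :+ t))) refl
             (suc (δ m)) ℓ (δ m) (degProduct xs) (Pr L) (excess xs) (length xs * (1 + k)) ⟩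
      weight (m ∷ xs) L ∎
      where open ≡-Reasoning

  card-good : ∀ {xs} → 1 ≤ length xs → AllPairs Fin._<_ xs → ∀ ℓ →
    HasCard (Good {ℓ} xs) (ℓ * weight xs (ℓ + excess xs))
  card-good {x ∷ xs} _ sorted ℓ = card-good-∷ sorted ℓ (card-headAt (length xs) refl sorted)

-- Regrouping sums and products over labels by degree.

indicator : Bool → ℕ
indicator b = if b then 1 else 0

occurrences : (A → ℕ) → ℕ → List A → ℕ
occurrences δ d xs = sum (map (λ x → indicator (d ≡ᵇ δ x)) xs)

∣∣≡sum : ∀ {n} (p : Subset n) (f : Fin n → Bool) → (∀ x → (x Subset.∈ p) ⇔ T (f x)) →
  Subset.∣ p ∣ ≡ sum (tabulate (indicator ∘ f))
∣∣≡sum []      f ∈⇔f = refl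
∣∣≡sum (b ∷ p) f ∈⇔f = head-case b (f zero) (∈⇔f zero)
  (∣∣≡sum p (f ∘ suc) (λ x → mk⇔ (to (∈⇔f (suc x)) ∘ Vec.there) (drop-there ∘ from (∈⇔f (suc x)))))
  where
  head-case : ∀ b c {N} → (zero Subset.∈ (b ∷ p)) ⇔ T c → Subset.∣ p ∣ ≡ N →
    Subset.∣ b ∷ p ∣ ≡ indicator c + N
  head-case true  true  h eq = cong suc eq
  head-case false false h eq = eq
  head-case true  false h eq = ⊥-elim (to h Vec.here)
  head-case false true  h eq with () ← from h tt

allFin-sorted : ∀ n → AllPairs Fin._<_ (allFin n)
allFin-sorted n = tabulate⁺-< id

-- `power d c` is the combination of `c` copies of `g d`. One argument then serves both the excess,
-- where it is `d * c`, and the product of the degrees, where it is `suc d ^ c`.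
module Regroup {_∙_ : ℕ → ℕ → ℕ} {ε : ℕ} (isCM : IsCommutativeMonoid _≡_ _∙_ ε)
  (power : ℕ → ℕ → ℕ) (g : ℕ → ℕ)
  (power-zero : ∀ d → power d 0 ≡ ε) (power-suc : ∀ d c → power d (suc c) ≡ g d ∙ power d c) where

  open IsCommutativeMonoid isCM using (assoc; comm; identityˡ; identityʳ)

  big : ℕ → (ℕ → ℕ) → ℕ
  big zero    f = ε
  big (suc m) f = big m f ∙ f m

  big-cong : ∀ m {f h : ℕ → ℕ} → (∀ d → f d ≡ h d) → big m f ≡ big m h
  big-cong zero    f≗h = refl
  big-cong (suc m) f≗h = cong₂ _∙_ (big-cong m f≗h) (f≗h m)

  big-ε : ∀ m → big m (λ d → power d 0) ≡ ε
  big-ε zero    = refl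
  big-ε (suc m) = trans (cong₂ _∙_ (big-ε m) (power-zero m)) (identityˡ ε)

  big-skip : ∀ m t (c : ℕ → ℕ) → m ≤ t →
    big m (λ d → power d (indicator (d ≡ᵇ t) + c d)) ≡ big m (λ d → power d (c d))
  big-skip zero    t c m≤t = refl
  big-skip (suc m) t c m<t = cong₂ _∙_ (big-skip m t c (<⇒≤ m<t)) (other (m ≡ᵇ t) refl)
    where
    other : ∀ b → (m ≡ᵇ t) ≡ b → power m (indicator b + c m) ≡ power m (c m)
    other false eq = refl
    other true  eq = ⊥-elim (<⇒≢ m<t (≡ᵇ⇒≡ m t (subst T (sym eq) tt)))

  -- Exactly one index below `m` equals `t`. There the count grows by one and yields a factor `g t`,
  -- which commutativity brings to the front; `big-skip` handles the indices below it.
  big-hit : ∀ m t (c : ℕ → ℕ) → t < m →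
    big m (λ d → power d (indicator (d ≡ᵇ t) + c d)) ≡ g t ∙ big m (λ d → power d (c d))
  big-hit (suc m) t c t<1+m = step (m ≡ᵇ t) refl
    where
    step : ∀ b → (m ≡ᵇ t) ≡ b →
      big m (λ d → power d (indicator (d ≡ᵇ t) + c d)) ∙ power m (indicator b + c m)
        ≡ g t ∙ (big m (λ d → power d (c d)) ∙ power m (c m))
    step true eq with refl ← ≡ᵇ⇒≡ m t (subst T (sym eq) tt) = begin
      big m (λ d → power d (indicator (d ≡ᵇ m) + c d)) ∙ power m (suc (c m))
        ≡⟨ cong₂ _∙_ (big-skip m m c ≤-refl) (power-suc m (c m)) ⟩
      b ∙ (g m ∙ power m (c m)) ≡⟨ assoc b _ _ ⟨
      (b ∙ g m) ∙ power m (c m) ≡⟨ cong (λ z → z ∙ power m (c m)) (comm b (g m)) ⟩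
      (g m ∙ b) ∙ power m (c m) ≡⟨ assoc _ b _ ⟩
      g m ∙ (b ∙ power m (c m)) ∎
      where
      open ≡-Reasoning
      b = big m (λ d → power d (c d))
    step false eq =
      trans (cong (λ z → z ∙ power m (c m)) (big-hit m t c (≤∧≢⇒< (s≤s⁻¹ t<1+m) t≢m)))
        (assoc (g t) _ _)
      where
      t≢m : t ≢ m
      t≢m t≡m = subst T eq (≡⇒≡ᵇ m t (sym t≡m))

  regroup : (δ : A → ℕ) → ∀ m xs → All (λ x → δ x < m) xs →
    foldr _∙_ ε (map (g ∘ δ) xs) ≡ big m (λ d → power d (occurrences δ d xs))
  regroup δ m []       []         = sym (big-ε m)
  regroup δ m (x ∷ xs) (δx<m ∷ δ<m) =
    trans (cong (_∙_ (g (δ x))) (regroup δ m xs δ<m))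
      (sym (big-hit m (δ x) (λ d → occurrences δ d xs) δx<m))

module RegroupSum = Regroup +-0-isCommutativeMonoid (λ d c → d * c) id *-zeroʳ *-suc
module RegroupProduct = Regroup *-1-isCommutativeMonoid (λ d c → suc d ^ c) suc (λ d → refl) (λ d c → refl)

-- The number of trees in terms of the type.

rAt>0⇒< : ∀ r d → 1 ≤ rAt r d → d < length r
rAt>0⇒< (x ∷ r) zero    _ = s≤s z≤n
rAt>0⇒< (x ∷ r) (suc d) p = s≤s (rAt>0⇒< r d p)

rAt-length : ∀ r → rAt r (length r) ≡ 0
rAt-length []      = refl
rAt-length (x ∷ r) = rAt-length r

-- The term at degree 0 is the only negative one and equals `- r₀`; the term at degree `suc d` is
-- `d * rAt r d`. Shifting the index by one leaves a sum of natural numbers.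
sumBelowℤ-ell : ∀ r₀ r m → sumBelowℤ (suc m) (λ d → (+ d ℤ.- + 1) ℤ.* + rAt (r₀ ∷ r) d)
  ≡ + RegroupSum.big m (λ d → d * rAt r d) ℤ.- + r₀
sumBelowℤ-ell r₀ r zero = solve 1 (λ x → con (+ 0) :+ con (ℤ.- + 1) :* x := con (+ 0) :- x) refl (+ r₀)
  where open ℤSolver.+-*-Solver
sumBelowℤ-ell r₀ r (suc m) = begin
  sumBelowℤ (suc m) _ ℤ.+ + m ℤ.* + rAt r m
    ≡⟨ cong₂ ℤ._+_ (sumBelowℤ-ell r₀ r m) (sym (ℤₚ.pos-* m (rAt r m))) ⟩
  X ℤ.- + r₀ ℤ.+ + (m * rAt r m)
    ≡⟨ solve 3 (λ x y z → x :- y :+ z := x :+ z :- y) refl X (+ r₀) (+ (m * rAt r m)) ⟩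
  X ℤ.+ + (m * rAt r m) ℤ.- + r₀ ≡⟨ cong (ℤ._- + r₀) (ℤₚ.pos-+ (RegroupSum.big m (λ d → d * rAt r d)) (m * rAt r m)) ⟨
  + (RegroupSum.big m (λ d → d * rAt r d) + m * rAt r m) ℤ.- + r₀ ∎
  where
  open ≡-Reasoning
  open ℤSolver.+-*-Solver
  X = + RegroupSum.big m (λ d → d * rAt r d)

-- Positivity of `ell` removes the absolute value. In terms of forests: the number of trees plus the
-- excess is the number of leaves.
∣ell∣-balance : ∀ r₀ r → + 1 ℤ.≤ ell (r₀ ∷ r) →
  ∣ ell (r₀ ∷ r) ∣ + RegroupSum.big (length r) (λ d → d * rAt r d) ≡ r₀
∣ell∣-balance r₀ r 1≤ell = ℤₚ.+-injective (begin
  + (∣ ell (r₀ ∷ r) ∣ + X)      ≡⟨ ℤₚ.pos-+ ∣ ell (r₀ ∷ r) ∣ X ⟩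
  + ∣ ell (r₀ ∷ r) ∣ ℤ.+ + X    ≡⟨ cong (ℤ._+ + X) (ℤₚ.0≤i⇒+∣i∣≡i (ℤₚ.≤-trans (ℤ.+≤+ z≤n) 1≤ell)) ⟩
  ell (r₀ ∷ r) ℤ.+ + X          ≡⟨ cong (λ s → ℤ.- s ℤ.+ + X) (sumBelowℤ-ell r₀ r (length r)) ⟩
  ℤ.- (+ X ℤ.- + r₀) ℤ.+ + X    ≡⟨ solve 2 (λ x y → :- (x :- y) :+ x := y) refl (+ X) (+ r₀) ⟩
  + r₀ ∎)
  where
  open ≡-Reasoning
  open ℤSolver.+-*-Solver
  X = RegroupSum.big (length r) (λ d → d * rAt r d)

prod1to≡big : ∀ m r₀ r → prod1to m (λ d → d ^ rAt (r₀ ∷ r) d) ≡ RegroupProduct.big m (λ d → suc d ^ rAt r d)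
prod1to≡big zero    r₀ r = refl
prod1to≡big (suc m) r₀ r = cong (λ p → p * suc m ^ rAt r m) (prod1to≡big m r₀ r)

-- Forests as lists and as vectors, and their degree counts.

module _ {n k : ℕ} where

  labelsF-toList : ∀ {ℓ} (F : Vec (CTree n k) ℓ) → labelsF (Vec.toList F) ≡ labelsV F
  labelsF-toList []      = refl
  labelsF-toList (t ∷ F) = cong (labelsT t ++_) (labelsF-toList F)

  degCountF-toList : ∀ {ℓ} i (F : Vec (CTree n k) ℓ) → degCountF i (Vec.toList F) ≡ degCountV i F
  degCountF-toList i []      = refl
  degCountF-toList i (t ∷ F) = cong (_+_ (degCountT i t)) (degCountF-toList i F)

  proper-toList : ∀ {ℓ} (F : Vec (CTree n k) ℓ) → ProperColoring (Vec.toList F) ⇔ ProperColoringV F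
  proper-toList []      = mk⇔ _ (λ _ → [])
  proper-toList (t ∷ F) = mk⇔ (λ { (p ∷ ps) → p , to (proper-toList F) ps })
                              (λ (p , ps) → p ∷ from (proper-toList F) ps)

  labelsIn-toList : ∀ {ℓ} S (F : Vec (CTree n k) ℓ) → LabelsIn S (Vec.toList F) ⇔ LabelsInV S F
  labelsIn-toList S []      = mk⇔ _ (λ _ → [])
  labelsIn-toList S (t ∷ F) = mk⇔ (λ { (p ∷ ps) → p , to (labelsIn-toList S F) ps })
                                  (λ (p , ps) → p ∷ from (labelsIn-toList S F) ps)

  -- Two lists without repetitions that have the same elements are permutations of each other, and
  -- `allFin n` contains every label once.
  isLabelling⇔↭ : (F : CForest n k) → IsLabelling F ⇔ (labelsF F ↭ allFin n)
  isLabelling⇔↭ F = mk⇔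
    (λ (uniq , total) → ∼bag⇒↭ (unique∧set⇒bag uniq (Uniqueₚ.allFin⁺ n)
                                  (mk⇔ (λ _ → ∈-allFin _) (λ _ → total _))))
    (λ F↭ → Permₚ.Unique-resp-↭ (setoid (Fin n)) (↭⇒↭ₛ (↭-sym F↭)) (Uniqueₚ.allFin⁺ n) ,
            (λ j → ∈-resp-↭ (↭-sym F↭) (∈-allFin j)))

  module _ (S : ℕ → Subset n) (δ : Fin n → ℕ) (∈S⇒δ : ∀ {x d} → x Subset.∈ S (suc d) → d ≡ δ x) where

    -- An internal vertex replaces one tree by `suc d` trees, so it adds `d` leaves to the one that
    -- each tree starts with.
    leaf-countT : (t : CTree n k) → LabelsInT S t → degCountT 0 t ≡ suc (sum (map δ (labelsT t)))
    leaf-countV : ∀ {ℓ} (F : Vec (CTree n k) ℓ) → LabelsInV S F → degCountV 0 F ≡ ℓ + sum (map δ (labelsV F))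
    leaf-countT leaf              _           = refl
    leaf-countT (node d x col ch) (x∈ , inS) =
      trans (leaf-countV ch inS) (cong (λ e → suc (e + sum (map δ (labelsV ch)))) (∈S⇒δ x∈))
    leaf-countV []      _            = refl
    leaf-countV {suc ℓ} (t ∷ F) (inT , inF) = begin
      degCountT 0 t + degCountV 0 F ≡⟨ cong₂ _+_ (leaf-countT t inT) (leaf-countV F inF) ⟩
      suc (a + (ℓ + b))             ≡⟨ solve 3 (λ a l b → con 1 :+ (a :+ (l :+ b)) := con 1 :+ l :+ (a :+ b)) refl a ℓ b ⟩
      suc ℓ + (a + b)               ≡⟨ cong (_+_ (suc ℓ)) (sum-++ (map δ (labelsT t)) _) ⟨
      suc ℓ + sum (map δ (labelsT t) ++ map δ (labelsV F))
                                    ≡⟨ cong (λ xs → suc ℓ + sum xs) (map-++ δ (labelsT t) (labelsV F)) ⟨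
      suc ℓ + sum (map δ (labelsV (t ∷ F))) ∎
      where
      open ≡-Reasoning
      open +-*-Solver
      a = sum (map δ (labelsT t))
      b = sum (map δ (labelsV F))

    degree-countT : ∀ e (t : CTree n k) → LabelsInT S t → degCountT (suc e) t ≡ occurrences δ e (labelsT t)
    degree-countV : ∀ {ℓ} e (F : Vec (CTree n k) ℓ) → LabelsInV S F →
      degCountV (suc e) F ≡ occurrences δ e (labelsV F)
    degree-countT e leaf              _          = refl
    degree-countT e (node d x col ch) (x∈ , inS) =
      cong₂ (λ d c → indicator (e ≡ᵇ d) + c) (∈S⇒δ x∈) (degree-countV e ch inS)
    degree-countV e []      _           = refl
    degree-countV e (t ∷ F) (inT , inF) =
      trans (cong₂ _+_ (degree-countT e t inT) (degree-countV e F inF))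
        (trans (sym (sum-++ (map f (labelsT t)) _)) (cong sum (sym (map-++ f (labelsT t) (labelsV F)))))
      where
      f : Fin n → ℕ
      f x = indicator (e ≡ᵇ δ x)

-- The count for a given type and a given partition of the labels.

theorem3p5 : (r : List ℕ) (k : ℕ) (S : ℕ → Subset (nInt r)) →
    1 ≤ nInt r → + 1 ℤ.≤ ell r → InV r S →
    HasCard (InCF r k S)
    (∣ ell r ∣ * prod1to (length r) (λ d → d ^ rAt r d)
    * prod1to (nInt r ∸ 1) (λ i → rAt r 0 + i * (1 + k)))
theorem3p5 [] k S () _ _
theorem3p5 (r₀ ∷ r) k S 1≤n 1≤ell (disjoint , cover , sizes) =
  subst (HasCard _) total
    (card-⇔ inCF⇔ (card-image Vec.toList toList-injective
      (card-good (subst (1 ≤_) (sym (length-tabulate id)) 1≤n) (allFin-sorted n) ℓ)))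
  where
  n = nInt (r₀ ∷ r)
  ℓ = ∣ ell (r₀ ∷ r) ∣

  -- The index supplied by `cover` is at least 1, so `suc (δ x)` recovers it.
  δ : Fin n → ℕ
  δ x = pred (proj₁ (cover x))

  ∈S : ∀ x → x Subset.∈ S (suc (δ x))
  ∈S x with cover x
  ... | suc d , _ , x∈ = x∈

  ∈S⇔δ : ∀ x d → (x Subset.∈ S (suc d)) ⇔ (d ≡ δ x)
  ∈S⇔δ x d = mk⇔ only (λ { refl → ∈S x })
    where
    only : x Subset.∈ S (suc d) → d ≡ δ x
    only x∈ with d ≟ δ x
    ... | yes eq = eq
    ... | no neq = ⊥-elim (disjoint (suc d) (suc (δ x)) (s≤s z≤n) (s≤s z≤n) (neq ∘ suc-injective) x x∈ (∈S x))

  open Counting k S δ ∈S⇔δ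

  occurrences≡rAt : ∀ d → occurrences δ d (allFin n) ≡ rAt r d
  occurrences≡rAt d = begin
    sum (map (λ x → indicator (d ≡ᵇ δ x)) (allFin n))
      ≡⟨ cong sum (map-tabulate id (λ x → indicator (d ≡ᵇ δ x))) ⟩
    sum (tabulate (λ x → indicator (d ≡ᵇ δ x)))
      ≡⟨ ∣∣≡sum (S (suc d)) (λ x → d ≡ᵇ δ x)
           (λ x → mk⇔ (≡⇒≡ᵇ d (δ x) ∘ to (∈S⇔δ x d)) (from (∈S⇔δ x d) ∘ ≡ᵇ⇒≡ d (δ x))) ⟨
    Subset.∣ S (suc d) ∣
      ≡⟨ sizes (suc d) (s≤s z≤n) ⟩
    rAt r d ∎
    where open ≡-Reasoning

  -- `S (suc (δ x))` contains `x`, so its size `rAt r (δ x)` is positive, whereas entries past the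
  -- end of `r` are 0.
  δ-bounded : All (λ x → δ x < length r) (allFin n)
  δ-bounded = All.tabulate (λ {x} _ → rAt>0⇒< r (δ x)
    (subst (1 ≤_) (sizes (suc (δ x)) (s≤s z≤n)) (≤-trans (s≤s z≤n) (x∈p⇒∣p-x∣<∣p∣ (∈S x)))))

  leaves : ℓ + excess (allFin n) ≡ r₀
  leaves = trans (cong (_+_ ℓ)
      (trans (RegroupSum.regroup δ (length r) (allFin n) δ-bounded)
        (RegroupSum.big-cong (length r) (λ d → cong (_*_ d) (occurrences≡rAt d)))))
    (∣ell∣-balance r₀ r 1≤ell)

  degProduct≡ : degProduct (allFin n) ≡ prod1to (length (r₀ ∷ r)) (λ d → d ^ rAt (r₀ ∷ r) d)
  degProduct≡ = begin
    degProduct (allFin n)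
      ≡⟨ RegroupProduct.regroup δ (length r) (allFin n) δ-bounded ⟩
    RegroupProduct.big (length r) (λ d → suc d ^ occurrences δ d (allFin n))
      ≡⟨ RegroupProduct.big-cong (length r) (λ d → cong (suc d ^_) (occurrences≡rAt d)) ⟩
    RegroupProduct.big (length r) (λ d → suc d ^ rAt r d)
      ≡⟨ prod1to≡big (length r) r₀ r ⟨
    prod1to (length r) (λ d → d ^ rAt (r₀ ∷ r) d)
      -- The product in the theorem runs one degree past the last entry of the type; that factor has
      -- exponent 0.
      ≡⟨ *-identityʳ _ ⟨
    prod1to (length r) (λ d → d ^ rAt (r₀ ∷ r) d) * 1
      ≡⟨ cong (λ e → prod1to (length r) (λ d → d ^ rAt (r₀ ∷ r) d) * suc (length r) ^ e) (rAt-length r) ⟨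
    prod1to (length (r₀ ∷ r)) (λ d → d ^ rAt (r₀ ∷ r) d) ∎
    where open ≡-Reasoning

  total : ℓ * weight (allFin n) (ℓ + excess (allFin n))
    ≡ ℓ * prod1to (length (r₀ ∷ r)) (λ d → d ^ rAt (r₀ ∷ r) d) * prod1to (n ∸ 1) (λ i → r₀ + i * (1 + k))
  total = trans (sym (*-assoc ℓ _ _)) (cong₂ (λ p q → ℓ * p * q) degProduct≡
    (cong₂ (λ len L → prod1to (len ∸ 1) (λ i → L + i * (1 + k))) (length-tabulate {n = n} id) leaves))

  toList-injective : ∀ {F G : Vec (CTree n k) ℓ} → Vec.toList F ≡ Vec.toList G → F ≡ G
  toList-injective {F} {G} eq = trans (sym (Vecₚ.cast-is-id refl F)) (Vecₚ.toList-injective refl F G eq)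

  -- `InCF` leaves the number of trees open, but the leaf count fixes it: `m + excess (allFin n)`
  -- and `ℓ + excess (allFin n)` both equal `r₀`. Conversely, `ℓ` and the labels determine all
  -- degree counts.
  good-toList : ∀ {m} (F : Vec (CTree n k) m) →
    (m ≡ ℓ × Good (allFin n) F) ⇔ InCF (r₀ ∷ r) k S (Vec.toList F)
  good-toList {m} F = mk⇔
    (λ { (m≡ℓ , labels , proper , inS) →
         isType m≡ℓ labels inS ,
         from (isLabelling⇔↭ (Vec.toList F)) (subst (_↭ allFin n) (sym (labelsF-toList F)) labels) ,
         from (proper-toList F) proper , from (labelsIn-toList S F) inS })
    (λ { (type , labelling , proper , inS) →
         let labels = subst (_↭ allFin n) (labelsF-toList F) (to (isLabelling⇔↭ (Vec.toList F)) labelling)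
             inS′ = to (labelsIn-toList S F) inS
         in +-cancelʳ-≡ (excess (allFin n)) m ℓ
              (trans (sym (leaf-count labels inS′)) (trans (type 0) (sym leaves))) ,
            labels , to (proper-toList F) proper , inS′ })
    where
    leaf-count : labelsV F ↭ allFin n → LabelsInV S F → degCountF 0 (Vec.toList F) ≡ m + excess (allFin n)
    leaf-count labels inS = trans (degCountF-toList 0 F)
      (trans (leaf-countV S δ (to (∈S⇔δ _ _)) F inS) (cong (_+_ m) (sum-↭ (map⁺ δ labels))))
    isType : m ≡ ℓ → labelsV F ↭ allFin n → LabelsInV S F → IsType (r₀ ∷ r) (Vec.toList F)
    isType m≡ℓ labels inS zero = trans (leaf-count labels inS)
      (trans (cong (λ m → m + excess (allFin n)) m≡ℓ) leaves)
    isType m≡ℓ labels inS (suc d) = trans (degCountF-toList (suc d) F)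
      (trans (degree-countV S δ (to (∈S⇔δ _ _)) d F inS)
        (trans (sum-↭ (map⁺ (λ x → indicator (d ≡ᵇ δ x)) labels)) (occurrences≡rAt d)))

  inCF⇔ : ∀ F → (∃[ G ] (Good {ℓ} (allFin n) G × F ≡ Vec.toList G)) ⇔ InCF (r₀ ∷ r) k S F
  inCF⇔ F = mk⇔
    (λ { (G , good , refl) → to (good-toList G) (refl , good) })
    (λ inCF → as-vector (Vec.fromList F) (Vecₚ.toList∘fromList F)
      (from (good-toList (Vec.fromList F)) (subst (InCF (r₀ ∷ r) k S) (sym (Vecₚ.toList∘fromList F)) inCF)))
    where
    -- The length of the list is made a variable, so that its equation with `ℓ` can be matched.
    as-vector : ∀ {m} (G : Vec (CTree n k) m) → Vec.toList G ≡ F → m ≡ ℓ × Good (allFin n) G →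
      ∃[ G ] (Good {ℓ} (allFin n) G × F ≡ Vec.toList G)
    as-vector G G≡F (refl , good) = G , good , sym G≡F
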